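{- Let $n\ge1$ and let $(f^B_{ij})_{0\le j\le i\le n}$ be the $f$-triangle of $\Delta_{\mathrm{SDyck}_{2n}}$. Then for $0\le j\le i\le n$ \[ f^B_{ij}=\Big|\left\{\,w\in\mathrm{SDyck}_{2n} : |V^{\mathrm{half}}(w)|=j\text{ and }\mu_B(w)=i\,\right\}\Big| . \]
   Context: A Dyck path of semilength $m$ is a word $w=w_1\cdots w_{2m}$ in $\{U,D\}$ with equally many $U$'s and $D$'s such that every prefix contains at least as many $U$'s as $D$'s. It is symmetric if $w_{2m+1-i}=\overline{w_i}$ for all $1\le i\le 2m$, where $\overline U=D$, $\overline D=U$. $\mathrm{SDyck}_{2n}$ is the set of symmetric Dyck paths of semilength $2n$ (length $4n$). A valley of $w$ is an index $i$ with $w_i=D$, $w_{i+1}=U$, identified with its position $(i,y)$, where $y$ is the number of $U$'s minus the number of $D$'s in $w_1\cdots w_i$; $V(w)$ is the set of valley positions. For $w\in\mathrm{SDyck}_{2n}$ put $V^{\mathrm{half}}(w)=\{(x,y)\in V(w): x\le 2n\}$, and $\Delta_{\mathrm{SDyck}_{2n}}=\{V^{\mathrm{half}}(w) : w\in\mathrm{SDyck}_{2n}\}$, which is a simplicial complex (isomorphic to the complex of antichains in the root poset of type $B_n$). Write $V^{\mathrm{half}}(w)=\{(x_1,y_1),\ldots,(x_\ell,y_\ell)\}$ with $x_1<\cdots<x_\ell$, and set $d_k=\frac{x_k-y_k}{2}$, $u_k=\frac{x_k+y_k}{2}$. If $\ell\ge1$ define \[ \mu_B(w)=d_1+\sum_{k=1}^{\ell-1}\min\{d_{k+1}-d_k,\;u_{k+1}-u_k\}+\left\lfloor\frac{2n-d_\ell-u_\ell}{2}\right\rfloor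 , \] and if $V^{\mathrm{half}}(w)=\varnothing$ set $\mu_B(w)=n$. For a simplicial complex $\Delta$, the degree of a face $\sigma$ is $\deg(\sigma)=\max\{|\tau| : \tau\in\Delta,\ \sigma\subseteq\tau\}$. The $f$-triangle of $\Delta$ is the array $(f_{ij})$ where $f_{ij}$ is the number of faces $\sigma$ with $|\sigma|=j$ and $\deg(\sigma)=i$. -}

module Defs where

open import Data.Fin.Base using (Fin; opposite)
import Data.Fin.Properties as Fin
open import Data.List.Base
  using (List; []; _∷_; _++_; map; filter; deduplicate; inits; length; lookup)
import Data.List.Extrema.Nat as Extrema
open import Data.List.Relation.Unary.All using (All; all?)
import Data.List.Relation.Binary.Subset.DecPropositional as DecSubset
open import Data.Nat.Base using (ℕ; zero; suc; pred; _+_; _*_; _∸_; _⊓_; _≤_; _/_)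
open import Data.Nat.Properties using (_≟_; _≤?_)
open import Data.Product.Base using (_×_; _,_; proj₁)
open import Data.Product.Properties using (≡-dec)
open import Relation.Binary.Definitions using (Decidable; DecidableEquality)
open import Relation.Binary.PropositionalEquality.Core using (_≡_; refl)
open import Relation.Nullary.Decidable using (Dec; yes; no; _×-dec_)

data Step : Set where
  U D : Step

infix 4 _≟ˢ_

_≟ˢ_ : DecidableEquality Step
U ≟ˢ U = yes refl
U ≟ˢ D = no λ ()
D ≟ˢ U = no λ ()
D ≟ˢ D = yes refl

flip : Step → Step
flip U = D
flip D = U

Word : Set
Word = List Step

#U #D : Word → ℕ
#U w = length (filter (_≟ˢ U) w)
#D w = length (filter (_≟ˢ D) w)

IsDyck : ℕ → Word → Set
IsDyck m w =
  length w ≡ 2 * m × #U w ≡ #D w × All (λ p → #D p ≤ #U p) (inits w)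

-- With 0-based indices, `opposite` is i ↦ 2m ∸ 1 ∸ i, which is the 1-based
-- i ↦ 2m + 1 ∸ i.
IsSymmetric : Word → Set
IsSymmetric w = ∀ (i : Fin (length w)) → lookup w (opposite i) ≡ flip (lookup w i)

IsSymDyck : ℕ → Word → Set
IsSymDyck m w = IsDyck m w × IsSymmetric w

isSymDyck? : ∀ m w → Dec (IsSymDyck m w)
isSymDyck? m w =
  ((length w ≟ 2 * m) ×-dec (#U w ≟ #D w)
    ×-dec all? (λ p → #D p ≤? #U p) (inits w))
  ×-dec Fin.all? (λ i → lookup w (opposite i) ≟ˢ flip (lookup w i))

-- Every word of length k, exactly once.
words : ℕ → List Word
words zero    = [] ∷ []
words (suc k) = map (U ∷_) (words k) ++ map (D ∷_) (words k)

-- Every symmetric Dyck path of semilength m, exactly once.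
SDyck : ℕ → List Word
SDyck m = filter (isSymDyck? m) (words (2 * m))

Position : Set
Position = ℕ × ℕ

_≟ᵖ_ : DecidableEquality Position
_≟ᵖ_ = ≡-dec _≟_ _≟_

-- `valleysFrom x y w` lists the valleys of a path suffix w that starts at
-- abscissa x and height y. On a Dyck path every D starts at positive height,
-- so `pred` never truncates.
valleysFrom : ℕ → ℕ → Word → List Position
valleysFrom x y []              = []
valleysFrom x y (U ∷ w)         = valleysFrom (suc x) (suc y) w
valleysFrom x y (D ∷ [])        = []
valleysFrom x y (D ∷ w@(U ∷ _)) = (suc x , pred y) ∷ valleysFrom (suc x) (pred y) w
valleysFrom x y (D ∷ w@(D ∷ _)) = valleysFrom (suc x) (pred y) w

V : Word → List Position
V = valleysFrom 0 0

-- The positions are listed by strictly increasing abscissa, hence without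
-- repetition, so `length` is the cardinality of the set of positions.
Vhalf : ℕ → Word → List Position
Vhalf n w = filter (λ p → proj₁ p ≤? 2 * n) (V w)

-- The number of D's (resp. U's) before a position of a Dyck path; there
-- y ≤ x and x ≡ y (mod 2), so both expressions are exact.
d u : Position → ℕ
d (x , y) = (x ∸ y) / 2
u (x , y) = (x + y) / 2

-- The part of μ_B after the summand d₁. Along a path d and u are weakly
-- increasing, and d + u = x ≤ 2n at each position, so no subtraction truncates.
μ-tail : ℕ → Position → List Position → ℕ
μ-tail n p []       = (2 * n ∸ d p ∸ u p) / 2
μ-tail n p (q ∷ qs) = ((d q ∸ d p) ⊓ (u q ∸ u p)) + μ-tail n q qs

μ-positions : ℕ → List Position → ℕ
μ-positions n []       = n
μ-positions n (p ∷ ps) = d p + μ-tail n p ps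

μB : ℕ → Word → ℕ
μB n w = μ-positions n (Vhalf n w)

-- A finite family of finite sets is a list of repetition-free lists, pairwise
-- distinct as sets; the cardinality of a member is its `length`.
module FiniteFamily {A : Set} (_≟ᴬ_ : DecidableEquality A) where

  open DecSubset _≟ᴬ_ using (_⊆_; _⊆?_)

  infix 4 _≐_ _≐?_

  _≐_ : List A → List A → Set
  σ ≐ τ = σ ⊆ τ × τ ⊆ σ

  _≐?_ : Decidable _≐_
  σ ≐? τ = (σ ⊆? τ) ×-dec (τ ⊆? σ)

  -- For a face σ of Δ the maximum is over a family containing ∣σ∣, so the
  -- default value 0 plays no role.
  degree : List (List A) → List A → ℕ
  degree Δ σ = Extrema.max 0 (map length (filter (σ ⊆?_) Δ))

  fTriangle : List (List A) → ℕ → ℕ → ℕ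
  fTriangle Δ i j =
    length (filter (λ σ → (length σ ≟ j) ×-dec (degree Δ σ ≟ i)) Δ)

open FiniteFamily _≟ᵖ_ public

ΔSDyck : ℕ → List (List Position)
ΔSDyck n = deduplicate _≐?_ (map (Vhalf n) (SDyck (2 * n)))

{-# OPTIONS --safe #-}

-- Record a valley by the numbers (a , b) of D's and U's before it. A symmetric
-- path of semilength 2n is determined by its first half, and the valleys of that
-- half form an arbitrary sequence of points that strictly increases in both
-- coordinates, starts after (0 , 0), and satisfies a ≤ b and a + b ≤ 2n. In such a
-- sequence the number of points that can be inserted is bounded gap by gap: a gap
-- from (a , b) to (c , d) contributes at most min(c − a, d − b) points, counting
-- (c , d), and diagonal steps attain this; after the last point (a , b) there is
-- room for ⌊(2n − a − b)/2⌋ diagonal steps. The sum of these bounds is μ_B, since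
-- the gap from (0 , 0) to the first point (a , b) has min(a, b) = a.
module Submission where

open import Data.Fin.Base using (zero; suc; opposite; inject₁; fromℕ)
import Data.Fin.Properties as Fin
open import Data.List.Base
  using (List; []; _∷_; _++_; length; map; filter; head; last; lookup; replicate; inits; take; drop;
         deduplicate)
open import Data.List.Extrema.Nat using (max≈v⁺)
open import Data.List.Membership.Propositional using (_∈_)
open import Data.List.Membership.Propositional.Properties
  using (∈-map⁺; ∈-map⁻; ∈-++⁺ˡ; ∈-++⁺ʳ; ∈-filter⁺; ∈-filter⁻)
open import Data.List.Properties
  using (length-++; length-map; length-take; length-replicate; ++-identityʳ; ++-assoc; ∷-injective;
         take++drop≡id; map-∘; map-id-local; filter-all; filter-none; filter-accept)
open import Data.List.Relation.Binary.Sublist.Propositional as Sublist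
  using ([]; _∷ʳ_; _∷_; minimum) renaming (_⊆_ to _⊑_)
open import Data.List.Relation.Binary.Sublist.Propositional.Properties using (All-resp-⊆; ++⁺ˡ)
import Data.List.Relation.Binary.Subset.DecPropositional as DecSubset
import Data.List.Relation.Binary.Subset.Propositional as Subset
import Data.List.Relation.Binary.Subset.Propositional.Properties as Subset
open import Data.List.Relation.Unary.All as All using (All; []; _∷_)
import Data.List.Relation.Unary.All.Properties as All
open import Data.List.Relation.Unary.AllPairs using (AllPairs; []; _∷_)
import Data.List.Relation.Unary.AllPairs.Properties as AllPairs
open import Data.List.Relation.Unary.Any using (here; there)
open import Data.List.Relation.Unary.Linked using (Linked; [-]; _∷_)
open import Data.List.Relation.Unary.Linked.Properties using (AllPairs⇒Linked; Linked⇒AllPairs)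
open import Data.List.Relation.Unary.Unique.Propositional using (Unique)
import Data.List.Relation.Unary.Unique.Propositional.Properties as Unique
open import Data.Maybe.Base using (just)
open import Data.Nat.Base
open import Data.Nat.DivMod using (/-monoˡ-≤; m/n*n≤m; m*n/n≡m; m/n≡1+[m∸n]/n)
open import Data.Nat.Properties
open import Data.Nat.Tactic.RingSolver using (solve-∀)
open import Data.Product.Base using (_×_; _,_; proj₁; proj₂; ∃-syntax; map₁; map₂)
open import Data.Vec.Base as Vec using (Vec; []; _∷_; fromList; toList)
open import Data.Vec.Properties
  using (toList-∷ʳ; toList∘fromList; toList-injective; tabulate∘lookup; tabulate-cong; cast-is-id)
open import Function.Base using (_∘_)
open import Function.Bundles using (_⇔_; mk⇔; Equivalence)
open import Level using (0ℓ)
open import Relation.Binary.Core using (Rel)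
import Relation.Binary.Definitions as B
open import Relation.Binary.Definitions using (Irreflexive; Transitive)
open import Relation.Binary.PropositionalEquality
open import Relation.Nullary.Decidable using (yes; no; _×-dec_; ¬?)
open import Relation.Nullary.Negation using (¬_; contradiction)
open import Relation.Unary using (Pred; Decidable)
open import Defs

-- Inclusion between strictly sorted lists.

module _ {A : Set} {R : Rel A 0ℓ} (irrefl : Irreflexive _≡_ R) (trans : Transitive R) where

  -- Turns inclusion of sets into a relation that admits induction. The head of `xs` is the head of
  -- `ys` or lies further on; in both cases the elements still to be placed come strictly after `y`,
  -- so irreflexivity lets the inclusion descend to the tail of `ys`.
  ⊆⇒⊑ : ∀ {xs ys} → AllPairs R xs → AllPairs R ys → xs Subset.⊆ ys → xs ⊑ ys
  ⊆⇒⊑ {[]}     {ys}     _ _ _ = minimum ys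
  ⊆⇒⊑ {x ∷ xs} {[]}     _ _ s with () ← s (here refl)
  ⊆⇒⊑ {x ∷ xs} {y ∷ ys} (px ∷ pxs) (py ∷ pys) s with s (here refl)
  ... | here refl = refl ∷ ⊆⇒⊑ pxs pys λ z∈xs → case (All.lookup px z∈xs) (s (there z∈xs))
    where
    case : ∀ {z} → R x z → z ∈ x ∷ ys → z ∈ ys
    case x<z (here refl) = contradiction x<z (irrefl refl)
    case _   (there z∈ys) = z∈ys
  ... | there x∈ys = y ∷ʳ ⊆⇒⊑ (px ∷ pxs) pys λ z∈ → case (below z∈) (s z∈)
    where
    below : ∀ {z} → z ∈ x ∷ xs → R y z
    below (here refl)  = All.lookup py x∈ys
    below (there z∈xs) = trans (All.lookup py x∈ys) (All.lookup px z∈xs)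
    case : ∀ {z} → R y z → z ∈ y ∷ ys → z ∈ ys
    case y<z (here refl) = contradiction y<z (irrefl refl)
    case _   (there z∈ys) = z∈ys

-- Chains of points and an upper bound for their extensions.

-- The point (a , b) stands for the lattice position reached after a D's and b U's.
Point : Set
Point = ℕ × ℕ

infix 4 _≺_

_≺_ : Rel Point 0ℓ
p ≺ q = proj₁ p < proj₁ q × proj₂ p < proj₂ q

≺-irrefl : Irreflexive _≡_ _≺_
≺-irrefl refl (a<a , _) = <-irrefl refl a<a

≺-trans : Transitive _≺_
≺-trans (a , b) (c , d) = <-trans a c , <-trans b d

Valid : ℕ → Point → Set
Valid N (a , b) = a ≤ b × a + b ≤ N

capacity : ℕ → Point → List Point → ℕ
capacity N (a , b) []             = (N ∸ a ∸ b) / 2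
capacity N (a , b) ((c , d) ∷ qs) = ((c ∸ a) ⊓ (d ∸ b)) + capacity N (c , d) qs

-- The price of inserting `r` after `p`: both sides of the next gap shrink by at least one, hence so
-- does their minimum. With no next point, the remaining room shrinks by at least two, which costs
-- one after halving.
capacity-≺ : ∀ {N p r qs} → p ≺ r → Valid N r → All (r ≺_) qs →
             suc (capacity N r qs) ≤ capacity N p qs
capacity-≺ {N} {a , b} {c , d} {[]} (a<c , b<d) (_ , c+d≤N) [] = begin
  suc ((N ∸ c ∸ d) / 2)               ≡⟨ m/n≡1+[m∸n]/n {2 + (N ∸ c ∸ d)} (s≤s (s≤s z≤n)) ⟨
  (2 + (N ∸ c ∸ d)) / 2               ≤⟨ /-monoˡ-≤ 2 (m+n≤o⇒m≤o∸n (2 + (N ∸ c ∸ d)) room) ⟩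
  (N ∸ (a + b)) / 2                   ≡⟨ cong (_/ 2) (∸-+-assoc N a b) ⟨
  (N ∸ a ∸ b) / 2                     ∎
  where
  open ≤-Reasoning
  regroup : ∀ k a b → 2 + k + (a + b) ≡ k + (suc a + suc b)
  regroup = solve-∀
  room : 2 + (N ∸ c ∸ d) + (a + b) ≤ N
  room = begin
    2 + (N ∸ c ∸ d) + (a + b)       ≡⟨ regroup (N ∸ c ∸ d) a b ⟩
    (N ∸ c ∸ d) + (suc a + suc b)   ≤⟨ +-monoʳ-≤ (N ∸ c ∸ d) (+-mono-≤ a<c b<d) ⟩
    (N ∸ c ∸ d) + (c + d)           ≡⟨ cong (_+ (c + d)) (∸-+-assoc N c d) ⟩
    (N ∸ (c + d)) + (c + d)         ≡⟨ m∸n+n≡m c+d≤N ⟩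
    N                               ∎
capacity-≺ {N} {qs = q ∷ qs} (a<c , b<d) _ ((c<e , d<f) ∷ _) =
  +-monoˡ-≤ (capacity N q qs)
    (⊓-mono-≤ (∸-monoʳ-< a<c (<⇒≤ c<e)) (∸-monoʳ-< b<d (<⇒≤ d<f)))

-- Induction along the embedding: an inserted point is paid for by `capacity-≺`, and a point of `qs`
-- by its own gap, whose two sides are positive.
length≤capacity : ∀ {N p qs rs} → AllPairs _≺_ (p ∷ rs) → All (Valid N) rs → qs ⊑ rs →
                  length rs ≤ capacity N p qs
length≤capacity _ _ [] = z≤n
length≤capacity ((p≺r ∷ _) ∷ pr@(r≺ ∷ _)) (vr ∷ vrs) (r ∷ʳ s) =
  ≤-trans (s≤s (length≤capacity pr vrs s)) (capacity-≺ p≺r vr (All-resp-⊆ s r≺))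
length≤capacity (((a<c , b<d) ∷ _) ∷ pr) (_ ∷ vrs) (refl ∷ s) =
  +-mono-≤ (⊓-glb (m<n⇒0<n∸m a<c) (m<n⇒0<n∸m b<d)) (length≤capacity pr vrs s)

-- Extensions that attain the bound.

diagonal : ℕ → Point → List Point
diagonal zero    _       = []
diagonal (suc k) (a , b) = (suc a , suc b) ∷ diagonal k (suc a , suc b)

length-diagonal : ∀ k p → length (diagonal k p) ≡ k
length-diagonal zero    _       = refl
length-diagonal (suc k) (a , b) = cong suc (length-diagonal k (suc a , suc b))

diagonal-linked : ∀ k a b {qs} → Linked _≺_ ((k + a , k + b) ∷ qs) →
                  Linked _≺_ ((a , b) ∷ diagonal k (a , b) ++ qs)
diagonal-linked zero    a b l = l
diagonal-linked (suc k) a b {qs} l = (≤-refl , ≤-refl) ∷ diagonal-linked k (suc a) (suc b)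
  (subst₂ (λ c d → Linked _≺_ ((c , d) ∷ qs)) (sym (+-suc k a)) (sym (+-suc k b)) l)

diagonal-valid : ∀ {N} k a b → a ≤ b → (k + a) + (k + b) ≤ N → All (Valid N) (diagonal k (a , b))
diagonal-valid zero    a b _   _    = []
diagonal-valid (suc k) a b a≤b room =
  (s≤s a≤b , ≤-trans (+-mono-≤ (m≤n+m (suc a) k) (m≤n+m (suc b) k)) room′)
  ∷ diagonal-valid k (suc a) (suc b) (s≤s a≤b) room′
  where
  room′ : (k + suc a) + (k + suc b) ≤ _
  room′ = ≤-trans (≤-reflexive (cong₂ _+_ (+-suc k a) (+-suc k b))) room

-- Each gap is filled with diagonal steps up to its shorter side, less one, because the capacity of
-- a gap also counts its endpoint `(c , d)`.
saturate : ℕ → Point → List Point → List Point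
saturate N (a , b) []             = diagonal ((N ∸ a ∸ b) / 2) (a , b)
saturate N (a , b) ((c , d) ∷ qs) =
  diagonal (pred ((c ∸ a) ⊓ (d ∸ b))) (a , b) ++ (c , d) ∷ saturate N (c , d) qs

⊑-saturate : ∀ N p qs → qs ⊑ saturate N p qs
⊑-saturate N p       []             = minimum _
⊑-saturate N (a , b) ((c , d) ∷ qs) = ++⁺ˡ (diagonal _ (a , b)) (refl ∷ ⊑-saturate N (c , d) qs)

pred-gap : ∀ {p q} → p ≺ q →
           let k = (proj₁ q ∸ proj₁ p) ⊓ (proj₂ q ∸ proj₂ p) in
           suc (pred k) ≡ k
pred-gap (a<c , b<d) =
  suc-pred _ {{>-nonZero (⊓-glb (m<n⇒0<n∸m a<c) (m<n⇒0<n∸m b<d))}}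

length-saturate : ∀ {N p qs} → Linked _≺_ (p ∷ qs) → length (saturate N p qs) ≡ capacity N p qs
length-saturate {N} {p} [-] = length-diagonal _ p
length-saturate {N} {a , b} {(c , d) ∷ qs} (p≺q ∷ l) = begin
  length (diagonal k (a , b) ++ (c , d) ∷ saturate N (c , d) qs)
    ≡⟨ length-++ (diagonal k (a , b)) ⟩
  length (diagonal k (a , b)) + suc (length (saturate N (c , d) qs))
    ≡⟨ cong₂ (λ x y → x + suc y) (length-diagonal k (a , b)) (length-saturate l) ⟩
  k + suc (capacity N (c , d) qs)
    ≡⟨ +-suc k _ ⟩
  suc k + capacity N (c , d) qs
    ≡⟨ cong (_+ capacity N (c , d) qs) (pred-gap p≺q) ⟩
  capacity N (a , b) ((c , d) ∷ qs) ∎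
  where
  open ≡-Reasoning
  k = pred ((c ∸ a) ⊓ (d ∸ b))

-- Since `k + 1` is the smaller of the two coordinate differences, `k` diagonal steps from `p` stop
-- at least one short of `q` in each coordinate.
gap-end : ∀ {p q} → p ≺ q →
          let k = pred ((proj₁ q ∸ proj₁ p) ⊓ (proj₂ q ∸ proj₂ p)) in
          (k + proj₁ p , k + proj₂ p) ≺ q
gap-end {a , b} {c , d} p≺q@(a<c , b<d) =
    below a<c (m⊓n≤m (c ∸ a) (d ∸ b))
  , below b<d (m⊓n≤n (c ∸ a) (d ∸ b))
  where
  k = pred ((c ∸ a) ⊓ (d ∸ b))
  below : ∀ {x z} → x < z → (c ∸ a) ⊓ (d ∸ b) ≤ z ∸ x → k + x < z
  below {x} x<z gap≤ = ≤-trans (+-monoˡ-≤ x (≤-trans (≤-reflexive (pred-gap p≺q)) gap≤))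
                               (≤-reflexive (m∸n+n≡m (<⇒≤ x<z)))

saturate-linked : ∀ {N p qs} → Linked _≺_ (p ∷ qs) → Linked _≺_ (p ∷ saturate N p qs)
saturate-linked {N} {a , b} [-] =
  subst (λ xs → Linked _≺_ ((a , b) ∷ xs)) (++-identityʳ _)
    (diagonal-linked ((N ∸ a ∸ b) / 2) a b [-])
saturate-linked {N} {a , b} (p≺q ∷ l) = diagonal-linked _ a b (gap-end p≺q ∷ saturate-linked l)

-- Diagonal steps preserve `a ≤ b`. Their coordinate sums are bounded by that of the next point or,
-- after the last point, by `N`, since `k * 2 ≤ N ∸ a ∸ b`.
saturate-valid : ∀ {N p qs} → Linked _≺_ (p ∷ qs) → All (Valid N) (p ∷ qs) →
                 All (Valid N) (saturate N p qs)
saturate-valid {N} {a , b} [-] ((a≤b , a+b≤N) ∷ []) = diagonal-valid k a b a≤b (begin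
  (k + a) + (k + b)       ≡⟨ regroup k a b ⟩
  k * 2 + (a + b)         ≤⟨ +-monoˡ-≤ (a + b) (m/n*n≤m (N ∸ a ∸ b) 2) ⟩
  (N ∸ a ∸ b) + (a + b)   ≡⟨ cong (_+ (a + b)) (∸-+-assoc N a b) ⟩
  (N ∸ (a + b)) + (a + b) ≡⟨ m∸n+n≡m a+b≤N ⟩
  N                       ∎)
  where
  open ≤-Reasoning
  k = (N ∸ a ∸ b) / 2
  regroup : ∀ k a b → (k + a) + (k + b) ≡ k * 2 + (a + b)
  regroup = solve-∀
saturate-valid {N} {a , b} (p≺q ∷ l) ((a≤b , _) ∷ vqs@((_ , c+d≤N) ∷ _)) =
  All.++⁺ (diagonal-valid _ a b a≤b
            (≤-trans (+-mono-≤ (<⇒≤ (proj₁ (gap-end p≺q))) (<⇒≤ (proj₂ (gap-end p≺q)))) c+d≤N))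
          (All.head vqs ∷ saturate-valid l vqs)

-- Mirror images, and paths indexed by height.

mirror : Word → Word
mirror []      = []
mirror (c ∷ w) = mirror w ++ flip c ∷ []

-- Starting `D∷_` at a successor builds in the condition on prefixes: no `D` can leave height 0.
data Path : ℕ → Word → ℕ → Set where
  []  : ∀ {z} → Path z [] z
  U∷_ : ∀ {x w z} → Path (suc x) w z → Path x (U ∷ w) z
  D∷_ : ∀ {x w z} → Path x w z → Path (suc x) (D ∷ w) z

infixr 5 U∷_ D∷_ _++ᵖ_

_++ᵖ_ : ∀ {x y z v w} → Path x v y → Path y w z → Path x (v ++ w) z
[]     ++ᵖ q = q
(U∷ p) ++ᵖ q = U∷ (p ++ᵖ q)
(D∷ p) ++ᵖ q = D∷ (p ++ᵖ q)

Path-split : ∀ {x z} v {w} → Path x (v ++ w) z → ∃[ y ] Path x v y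
Path-split []      p      = _ , []
Path-split (U ∷ v) (U∷ p) = map₂ U∷_ (Path-split v p)
Path-split (D ∷ v) (D∷ p) = map₂ D∷_ (Path-split v p)

Path-mirror : ∀ {x w z} → Path x w z → Path z (mirror w) x
Path-mirror []     = []
Path-mirror (U∷ p) = Path-mirror p ++ᵖ D∷ []
Path-mirror (D∷ p) = Path-mirror p ++ᵖ U∷ []

Path⇒prefixes : ∀ {x w z} → Path x w z → All (λ p → #D p ≤ x + #U p) (inits w)
Path⇒prefixes         []     = z≤n ∷ []
Path⇒prefixes {x}     (U∷ p) = z≤n ∷ All.map⁺
  (All.map (λ le → ≤-trans le (≤-reflexive (sym (+-suc x _)))) (Path⇒prefixes p))
Path⇒prefixes {suc x} (D∷ p) = z≤n ∷ All.map⁺ (All.map s≤s (Path⇒prefixes p))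

Path⇒balance : ∀ {x w z} → Path x w z → x + #U w ≡ z + #D w
Path⇒balance         []     = refl
Path⇒balance {x}     (U∷ p) = trans (+-suc x _) (Path⇒balance p)
Path⇒balance {z = z} (D∷ p) = trans (cong suc (Path⇒balance p)) (sym (+-suc z _))

prefixes⇒Path : ∀ {x z} w → All (λ p → #D p ≤ x + #U p) (inits w) → x + #U w ≡ z + #D w →
                Path x w z
prefixes⇒Path {x} {z} [] _ eq with refl ← +-cancelʳ-≡ 0 x z eq = []
prefixes⇒Path {x} (U ∷ w) (_ ∷ ps) eq = U∷ prefixes⇒Path w
  (All.map (λ le → ≤-trans le (≤-reflexive (+-suc x _))) (All.map⁻ ps)) (trans (sym (+-suc x _)) eq)
-- The one-letter prefix `D` already violates the hypothesis.
prefixes⇒Path {zero}  (D ∷ w) (_ ∷ ps) eq with () ∷ _ ← All.map⁻ ps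
prefixes⇒Path {suc x} {z} (D ∷ w) (_ ∷ ps) eq = D∷ prefixes⇒Path w
  (All.map s≤s⁻¹ (All.map⁻ ps)) (suc-injective (trans eq (+-suc z _)))

-- Valleys of a first half.

-- The valleys, as points, of a first half w continued by its mirror image:
-- a final D is followed by U, so it contributes a valley.
valleys : ℕ → ℕ → Word → List Point
valleys a b []              = []
valleys a b (U ∷ w)         = valleys a (suc b) w
valleys a b (D ∷ [])        = (suc a , b) ∷ []
valleys a b (D ∷ w@(U ∷ _)) = (suc a , b) ∷ valleys (suc a) b w
valleys a b (D ∷ w@(D ∷ _)) = valleys (suc a) b w

position : Point → Position
position (a , b) = a + b , b ∸ a

valleysFrom-x : ∀ x y w → All (λ p → x < proj₁ p) (valleysFrom x y w)
valleysFrom-x x y []          = []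
valleysFrom-x x y (U ∷ w)     = All.map (<-trans (n<1+n x)) (valleysFrom-x (suc x) (suc y) w)
valleysFrom-x x y (D ∷ [])    = []
valleysFrom-x x y (D ∷ U ∷ w) = ≤-refl ∷ All.map (<-trans (n<1+n x)) (valleysFrom-x (suc x) (pred y) (U ∷ w))
valleysFrom-x x y (D ∷ D ∷ w) = All.map (<-trans (n<1+n x)) (valleysFrom-x (suc x) (pred y) (D ∷ w))

last-∷ : ∀ {s} c (w : Word) → last w ≡ just s → last (c ∷ w) ≡ just s
last-∷ c (_ ∷ _) eq = eq

move-suc : ∀ a b l → a + suc b + l ≡ a + b + suc l
move-suc = solve-∀

-- The cutoff `N` falls at the end of `w`, and valleys inside `t` lie beyond it. Only a valley at
-- `N` itself depends on `t`, and `turn` provides it when `w` ends in `D`. The invariant `a + y ≡ b`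
-- identifies `y` with the second coordinate of `position`.
filter-valleysFrom : ∀ {N z} a b y w t → a + b + length w ≡ N → a + y ≡ b → Path y w z →
                     (last w ≡ just D → head t ≡ just U) →
                     filter (λ p → proj₁ p ≤? N) (valleysFrom (a + b) y (w ++ t))
                       ≡ map position (valleys a b w)
filter-valleysFrom {N} a b y [] t len _ _ _ =
  filter-none _ (All.map (λ x<p p≤N → <⇒≱ x<p (≤-trans p≤N N≤x)) (valleysFrom-x (a + b) y t))
  where
  N≤x : N ≤ a + b
  N≤x = ≤-reflexive (trans (sym len) (+-identityʳ (a + b)))
filter-valleysFrom a b y (U ∷ w) t len ht (U∷ p) turn rewrite sym (+-suc a b) =
  filter-valleysFrom a (suc b) (suc y) w t (trans (move-suc a b (length w)) len)
    (trans (+-suc a y) (cong suc ht)) p (turn ∘ last-∷ U w)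
filter-valleysFrom {N} a b .(suc y) (D ∷ w) t len ht (D∷_ {x = y} p) turn =
  go w t (trans (sym (+-suc (a + b) (length w))) len) p turn
  where
  open ≡-Reasoning
  P? = λ (p : Position) → proj₁ p ≤? N
  ht′ : suc a + y ≡ b
  ht′ = trans (sym (+-suc a y)) ht
  position≡ : (suc (a + b) , y) ≡ position (suc a , b)
  position≡ = cong (suc (a + b) ,_) (trans (sym (m+n∸m≡n (suc a) y)) (cong (_∸ suc a) ht′))
  go : ∀ {z} w t → suc a + b + length w ≡ N → Path y w z →
       (last (D ∷ w) ≡ just D → head t ≡ just U) →
       filter P? (valleysFrom (a + b) (suc y) (D ∷ w ++ t)) ≡ map position (valleys a b (D ∷ w))
  go [] []      _ _ turn with () ← turn refl
  go [] (D ∷ _) _ _ turn with () ← turn refl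
  go [] (U ∷ t) len [] turn = begin
    filter P? ((suc (a + b) , y) ∷ valleysFrom (suc (a + b)) y (U ∷ t))
      ≡⟨ filter-accept P? (m+n≤o⇒m≤o (suc (a + b)) (≤-reflexive len)) ⟩
    (suc (a + b) , y) ∷ filter P? (valleysFrom (suc (a + b)) y (U ∷ t))
      ≡⟨ cong₂ _∷_ position≡ (filter-valleysFrom (suc a) b y [] (U ∷ t) len ht′ [] λ ()) ⟩
    position (suc a , b) ∷ [] ∎
  go (U ∷ w) t len p turn = begin
    filter P? ((suc (a + b) , y) ∷ valleysFrom (suc (a + b)) y (U ∷ w ++ t))
      ≡⟨ filter-accept P? (m+n≤o⇒m≤o (suc (a + b)) (≤-reflexive len)) ⟩
    (suc (a + b) , y) ∷ filter P? (valleysFrom (suc (a + b)) y (U ∷ w ++ t))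
      ≡⟨ cong₂ _∷_ position≡ (filter-valleysFrom (suc a) b y (U ∷ w) t len ht′ p turn) ⟩
    position (suc a , b) ∷ map position (valleys (suc a) b (U ∷ w)) ∎
  go (D ∷ w) t len p turn = filter-valleysFrom (suc a) b y (D ∷ w) t len ht′ p turn

valleys-after : ∀ a b w → All (λ q → a < proj₁ q × b ≤ proj₂ q) (valleys a b w)
valleys-after a b []          = []
valleys-after a b (U ∷ w)     = All.map (map₂ <⇒≤) (valleys-after a (suc b) w)
valleys-after a b (D ∷ [])    = (≤-refl , ≤-refl) ∷ []
valleys-after a b (D ∷ U ∷ w) = (≤-refl , ≤-refl) ∷ All.map (map₁ <⇒≤) (valleys-after (suc a) b (U ∷ w))
valleys-after a b (D ∷ D ∷ w) = All.map (map₁ <⇒≤) (valleys-after (suc a) b (D ∷ w))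

valleys-sorted : ∀ a b w → AllPairs _≺_ (valleys a b w)
valleys-sorted a b []          = []
valleys-sorted a b (U ∷ w)     = valleys-sorted a (suc b) w
valleys-sorted a b (D ∷ [])    = [] ∷ []
-- The `U` after the valley raises the second bound to `suc b`, which makes the comparison strict in
-- both coordinates.
valleys-sorted a b (D ∷ U ∷ w) = valleys-after (suc a) (suc b) w ∷ valleys-sorted (suc a) b (U ∷ w)
valleys-sorted a b (D ∷ D ∷ w) = valleys-sorted (suc a) b (D ∷ w)

-- The height `y` is the surplus of U's over D's, so a path that reaches a valley at a natural
-- height has `a ≤ b` there.
valleys-valid : ∀ {y w z} a b → a + y ≡ b → Path y w z →
                All (Valid (a + b + length w)) (valleys a b w)
valleys-valid a b ht [] = []
valleys-valid {y} {U ∷ w} a b ht (U∷ p) =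
  subst (λ N → All (Valid N) (valleys a (suc b) w)) (move-suc a b (length w))
    (valleys-valid a (suc b) (trans (+-suc a y) (cong suc ht)) p)
valleys-valid {suc y} {D ∷ w} a b ht (D∷ p) =
  subst (λ N → All (Valid N) (valleys a b (D ∷ w))) (sym (+-suc (a + b) (length w))) (go w p)
  where
  ht′ : suc a + y ≡ b
  ht′ = trans (sym (+-suc a y)) ht
  valley : ∀ l → Valid (suc a + b + l) (suc a , b)
  valley l = m+n≤o⇒m≤o (suc a) (≤-reflexive ht′) , m≤m+n _ l
  go : ∀ {z} w → Path y w z → All (Valid (suc a + b + length w)) (valleys a b (D ∷ w))
  go []      [] = valley 0 ∷ []
  go (U ∷ w) p  = valley (length (U ∷ w)) ∷ valleys-valid (suc a) b ht′ p
  go (D ∷ w) p  = valleys-valid (suc a) b ht′ p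

-- A half of given length is determined by its valleys.

valleys-D : ∀ a b w → ∃[ c ] ∃[ qs ] valleys a b (D ∷ w) ≡ (c , b) ∷ qs
valleys-D a b []      = _ , _ , refl
valleys-D a b (U ∷ w) = _ , _ , refl
valleys-D a b (D ∷ w) = valleys-D (suc a) b w

-- After `U` every valley has more than `b` U's before it, whereas the first valley after `D` has
-- exactly `b`.
valleys-U≢D : ∀ a b v w → valleys a b (U ∷ v) ≢ valleys a b (D ∷ w)
valleys-U≢D a b v w eq with _ , _ , eqD ← valleys-D a b w
  with (_ , b<b) ∷ _ ← subst (All _) (trans eq eqD) (valleys-after a (suc b) v) = <-irrefl refl b<b

-- `D ∷ U` puts a valley after `suc a` D's; a second `D` pushes every valley beyond that.
valleys-DU≢DD : ∀ a b v w → valleys a b (D ∷ U ∷ v) ≢ valleys a b (D ∷ D ∷ w)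
valleys-DU≢DD a b v w eq
  with (a<a , _) ∷ _ ← subst (All _) (sym eq) (valleys-after (suc a) b (D ∷ w)) = <-irrefl refl a<a

valleys-injective : ∀ a b v w → length v ≡ length w → valleys a b v ≡ valleys a b w → v ≡ w
valleys-injective a b []          []          _   _  = refl
valleys-injective a b (U ∷ v)     (U ∷ w)     len eq =
  cong (U ∷_) (valleys-injective a (suc b) v w (suc-injective len) eq)
valleys-injective a b (U ∷ v)     (D ∷ w)     len eq = contradiction eq (valleys-U≢D a b v w)
valleys-injective a b (D ∷ v)     (U ∷ w)     len eq = contradiction (sym eq) (valleys-U≢D a b w v)
valleys-injective a b (D ∷ [])    (D ∷ [])    len eq = refl
valleys-injective a b (D ∷ U ∷ v) (D ∷ U ∷ w) len eq =
  cong (D ∷_) (valleys-injective (suc a) b (U ∷ v) (U ∷ w) (suc-injective len) (proj₂ (∷-injective eq)))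
valleys-injective a b (D ∷ U ∷ v) (D ∷ D ∷ w) len eq = contradiction eq (valleys-DU≢DD a b v w)
valleys-injective a b (D ∷ D ∷ v) (D ∷ U ∷ w) len eq = contradiction (sym eq) (valleys-DU≢DD a b w v)
valleys-injective a b (D ∷ D ∷ v) (D ∷ D ∷ w) len eq =
  cong (D ∷_) (valleys-injective (suc a) b (D ∷ v) (D ∷ w) (suc-injective len) eq)

-- Constructing a half with prescribed valleys.

-- A right inverse of `valleys` on chains: between consecutive valleys all U's precede all D's, so
-- no other valley arises, and a last run of U's fills the length up to `N`.
halfPath : ℕ → Point → List Point → Word
halfPath N (a , b) []             = replicate (N ∸ a ∸ b) U
halfPath N (a , b) ((c , d) ∷ qs) =
  replicate (d ∸ b) U ++ replicate (c ∸ a) D ++ halfPath N (c , d) qs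

valleys-U^k : ∀ k a b w → valleys a b (replicate k U ++ w) ≡ valleys a (k + b) w
valleys-U^k zero    a b w = refl
valleys-U^k (suc k) a b w = trans (valleys-U^k k a (suc b) w) (cong (λ b → valleys a b w) (+-suc k b))

valleys-D^k : ∀ k a b w → head w ≢ just D →
              valleys a b (replicate (suc k) D ++ w) ≡ (suc k + a , b) ∷ valleys (suc k + a) b w
valleys-D^k zero    a b []      ≢D = refl
valleys-D^k zero    a b (U ∷ w) ≢D = refl
valleys-D^k zero    a b (D ∷ w) ≢D = contradiction refl ≢D
valleys-D^k (suc k) a b w       ≢D =
  trans (valleys-D^k k (suc a) b w ≢D) (cong (λ a → (a , b) ∷ valleys a b w) (cong suc (+-suc k a)))

-- Makes each run of D's end at its intended valley: the next block opens with `d ∸ b > 0` U's, and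
-- the final block contains no `D`.
head-halfPath : ∀ {N p qs} → Linked _≺_ (p ∷ qs) → head (halfPath N p qs) ≢ just D
head-halfPath {N} {a , b} [-] with N ∸ a ∸ b
... | zero  = λ ()
... | suc _ = λ ()
head-halfPath {N} {a , b} {(c , d) ∷ qs} ((_ , b<d) ∷ _) with d ∸ b | m<n⇒0<n∸m b<d
... | suc _ | _ = λ ()

valleys-halfPath : ∀ {N a b qs} → Linked _≺_ ((a , b) ∷ qs) → valleys a b (halfPath N (a , b) qs) ≡ qs
valleys-halfPath {N} {a} {b} [-] =
  trans (cong (valleys a b) (sym (++-identityʳ (replicate (N ∸ a ∸ b) U)))) (valleys-U^k (N ∸ a ∸ b) a b [])
valleys-halfPath {N} {a} {b} {(c , d) ∷ qs} ((a<c , b<d) ∷ l) = begin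
  valleys a b (replicate (d ∸ b) U ++ replicate (c ∸ a) D ++ rest)
    ≡⟨ valleys-U^k (d ∸ b) a b _ ⟩
  valleys a (d ∸ b + b) (replicate (c ∸ a) D ++ rest)
    ≡⟨ cong (λ b → valleys a b (replicate (c ∸ a) D ++ rest)) (m∸n+n≡m (<⇒≤ b<d)) ⟩
  valleys a d (replicate (c ∸ a) D ++ rest)
    ≡⟨ cong (λ k → valleys a d (replicate k D ++ rest)) (suc-pred (c ∸ a)) ⟨
  valleys a d (replicate (suc (pred (c ∸ a))) D ++ rest)
    ≡⟨ valleys-D^k _ a d rest (head-halfPath l) ⟩
  (suc (pred (c ∸ a)) + a , d) ∷ valleys (suc (pred (c ∸ a)) + a) d rest
    ≡⟨ cong (λ c → (c , d) ∷ valleys c d rest)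
            (trans (cong (_+ a) (suc-pred (c ∸ a))) (m∸n+n≡m (<⇒≤ a<c))) ⟩
  (c , d) ∷ valleys c d rest
    ≡⟨ cong ((c , d) ∷_) (valleys-halfPath l) ⟩
  (c , d) ∷ qs ∎
  where
  open ≡-Reasoning
  rest = halfPath N (c , d) qs
  instance
    gap≢0 : NonZero (c ∸ a)
    gap≢0 = >-nonZero (m<n⇒0<n∸m a<c)

length-halfPath : ∀ {N a b qs} → Linked _≺_ ((a , b) ∷ qs) → All (Valid N) ((a , b) ∷ qs) →
                  a + b + length (halfPath N (a , b) qs) ≡ N
length-halfPath {N} {a} {b} [-] ((_ , a+b≤N) ∷ []) =
  trans (cong (a + b +_) (trans (length-replicate (N ∸ a ∸ b)) (∸-+-assoc N a b))) (m+[n∸m]≡n a+b≤N)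
length-halfPath {N} {a} {b} {(c , d) ∷ qs} ((a<c , b<d) ∷ l) (_ ∷ v) = begin
  a + b + length (replicate (d ∸ b) U ++ replicate (c ∸ a) D ++ rest)
    ≡⟨ cong (a + b +_) (length-++ (replicate (d ∸ b) U)) ⟩
  a + b + (length (replicate (d ∸ b) U) + length (replicate (c ∸ a) D ++ rest))
    ≡⟨ cong₂ (λ k l → a + b + (k + l)) (length-replicate (d ∸ b)) (length-++ (replicate (c ∸ a) D)) ⟩
  a + b + (d ∸ b + (length (replicate (c ∸ a) D) + length rest))
    ≡⟨ cong (λ k → a + b + (d ∸ b + (k + length rest))) (length-replicate (c ∸ a)) ⟩
  a + b + (d ∸ b + (c ∸ a + length rest))
    ≡⟨ regroup a b (d ∸ b) (c ∸ a) (length rest) ⟩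
  (c ∸ a + a) + (d ∸ b + b) + length rest
    ≡⟨ cong₂ (λ c d → c + d + length rest) (m∸n+n≡m (<⇒≤ a<c)) (m∸n+n≡m (<⇒≤ b<d)) ⟩
  c + d + length rest
    ≡⟨ length-halfPath l v ⟩
  N ∎
  where
  open ≡-Reasoning
  rest = halfPath N (c , d) qs
  regroup : ∀ a b k l m → a + b + (k + (l + m)) ≡ (l + a) + (k + b) + m
  regroup = solve-∀

Path-U^k : ∀ k {y} → Path y (replicate k U) (k + y)
Path-U^k zero        = []
Path-U^k (suc k) {y} = U∷ subst (Path (suc y) (replicate k U)) (+-suc k y) (Path-U^k k)

Path-D^k : ∀ k {y} → Path (k + y) (replicate k D) y
Path-D^k zero    = []
Path-D^k (suc k) = D∷ Path-D^k k

-- Each block climbs and then descends to its valley, at height `d ∸ c`; since `c ≤ d`, no descent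
-- passes below 0.
Path-halfPath : ∀ {N a b y qs} → Linked _≺_ ((a , b) ∷ qs) → All (Valid N) qs → a + y ≡ b →
                ∃[ z ] Path y (halfPath N (a , b) qs) z
Path-halfPath [-] _ _ = _ , Path-U^k _
Path-halfPath {N} {a} {b} {y} {(c , d) ∷ qs} ((a<c , b<d) ∷ l) ((c≤d , _) ∷ v) ht =
  map₂ (λ p → Path-U^k (d ∸ b)
              ++ᵖ subst (λ x → Path x (replicate (c ∸ a) D) (d ∸ c)) (sym heights) (Path-D^k (c ∸ a))
              ++ᵖ p)
    (Path-halfPath l v (m+[n∸m]≡n c≤d))
  where
  open ≡-Reasoning
  swap : ∀ k a h → k + a + h ≡ k + h + a
  swap = solve-∀
  heights : d ∸ b + y ≡ c ∸ a + (d ∸ c)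
  heights = +-cancelʳ-≡ a _ _ (begin
    d ∸ b + y + a          ≡⟨ swap (d ∸ b) y a ⟩
    d ∸ b + a + y          ≡⟨ +-assoc (d ∸ b) a y ⟩
    d ∸ b + (a + y)        ≡⟨ cong (d ∸ b +_) ht ⟩
    d ∸ b + b              ≡⟨ m∸n+n≡m (<⇒≤ b<d) ⟩
    d                      ≡⟨ m+[n∸m]≡n c≤d ⟨
    c + (d ∸ c)            ≡⟨ cong (_+ (d ∸ c)) (m∸n+n≡m (<⇒≤ a<c)) ⟨
    c ∸ a + a + (d ∸ c)    ≡⟨ swap (c ∸ a) a (d ∸ c) ⟩
    c ∸ a + (d ∸ c) + a    ∎)

-- Symmetry as invariance under `mirror`.

-- Vectors keep `opposite` on one type `Fin k`, whereas the length of `mirror w` equals that of `w`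
-- only propositionally.
mirrorᵛ : ∀ {k} → Vec Step k → Vec Step k
mirrorᵛ []      = []
mirrorᵛ (c ∷ v) = mirrorᵛ v Vec.∷ʳ flip c

toList-mirrorᵛ : ∀ w → toList (mirrorᵛ (fromList w)) ≡ mirror w
toList-mirrorᵛ []      = refl
toList-mirrorᵛ (c ∷ w) =
  trans (toList-∷ʳ (flip c) (mirrorᵛ (fromList w))) (cong (_++ flip c ∷ []) (toList-mirrorᵛ w))

module _ {A : Set} where

  lookup-∷ʳ-last : ∀ {k} (v : Vec A k) x → Vec.lookup (v Vec.∷ʳ x) (fromℕ k) ≡ x
  lookup-∷ʳ-last []      x = refl
  lookup-∷ʳ-last (_ ∷ v) x = lookup-∷ʳ-last v x

  lookup-∷ʳ-inject₁ : ∀ {k} (v : Vec A k) x i → Vec.lookup (v Vec.∷ʳ x) (inject₁ i) ≡ Vec.lookup v i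
  lookup-∷ʳ-inject₁ (_ ∷ v) x zero    = refl
  lookup-∷ʳ-inject₁ (_ ∷ v) x (suc i) = lookup-∷ʳ-inject₁ v x i

  lookup-fromList : ∀ (xs : List A) i → Vec.lookup (fromList xs) i ≡ lookup xs i
  lookup-fromList (_ ∷ xs) zero    = refl
  lookup-fromList (_ ∷ xs) (suc i) = lookup-fromList xs i

  lookup-ext : ∀ {k} {v w : Vec A k} → (∀ i → Vec.lookup v i ≡ Vec.lookup w i) → v ≡ w
  lookup-ext {v = v} {w} eq =
    trans (sym (tabulate∘lookup v)) (trans (tabulate-cong eq) (tabulate∘lookup w))

lookup-mirrorᵛ : ∀ {k} (v : Vec Step k) i → Vec.lookup (mirrorᵛ v) (opposite i) ≡ flip (Vec.lookup v i)
lookup-mirrorᵛ (c ∷ v) zero    = lookup-∷ʳ-last (mirrorᵛ v) (flip c)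
lookup-mirrorᵛ (c ∷ v) (suc i) =
  trans (lookup-∷ʳ-inject₁ (mirrorᵛ v) (flip c) (opposite i)) (lookup-mirrorᵛ v i)

symmetric⇒mirror : ∀ w → IsSymmetric w → mirror w ≡ w
symmetric⇒mirror w symm = begin
  mirror w                       ≡⟨ toList-mirrorᵛ w ⟨
  toList (mirrorᵛ (fromList w))  ≡⟨ cong toList (lookup-ext agree) ⟩
  toList (fromList w)            ≡⟨ toList∘fromList w ⟩
  w                              ∎
  where
  open ≡-Reasoning
  agree : ∀ i → Vec.lookup (mirrorᵛ (fromList w)) i ≡ Vec.lookup (fromList w) i
  agree i = begin
    Vec.lookup (mirrorᵛ (fromList w)) i
      ≡⟨ cong (Vec.lookup (mirrorᵛ (fromList w))) (Fin.opposite-involutive i) ⟨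
    Vec.lookup (mirrorᵛ (fromList w)) (opposite (opposite i))
      ≡⟨ lookup-mirrorᵛ (fromList w) (opposite i) ⟩
    flip (Vec.lookup (fromList w) (opposite i))
      ≡⟨ cong flip (lookup-fromList w (opposite i)) ⟩
    flip (lookup w (opposite i))
      ≡⟨ symm (opposite i) ⟨
    lookup w (opposite (opposite i))
      ≡⟨ cong (lookup w) (Fin.opposite-involutive i) ⟩
    lookup w i
      ≡⟨ lookup-fromList w i ⟨
    Vec.lookup (fromList w) i ∎

mirror⇒symmetric : ∀ w → mirror w ≡ w → IsSymmetric w
mirror⇒symmetric w eq i = begin
  lookup w (opposite i)                            ≡⟨ lookup-fromList w (opposite i) ⟨
  Vec.lookup (fromList w) (opposite i)             ≡⟨ cong (λ v → Vec.lookup v (opposite i)) eqᵛ ⟨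
  Vec.lookup (mirrorᵛ (fromList w)) (opposite i)   ≡⟨ lookup-mirrorᵛ (fromList w) i ⟩
  flip (Vec.lookup (fromList w) i)                 ≡⟨ cong flip (lookup-fromList w i) ⟩
  flip (lookup w i)                                ∎
  where
  open ≡-Reasoning
  eqᵛ : mirrorᵛ (fromList w) ≡ fromList w
  eqᵛ = trans (sym (cast-is-id refl _)) (toList-injective refl _ _
    (trans (toList-mirrorᵛ w) (trans eq (sym (toList∘fromList w)))))

-- Symmetric Dyck paths as a half followed by its mirror image.

flip-involutive : ∀ c → flip (flip c) ≡ c
flip-involutive U = refl
flip-involutive D = refl

mirror-++ : ∀ v w → mirror (v ++ w) ≡ mirror w ++ mirror v
mirror-++ []      w = sym (++-identityʳ (mirror w))
mirror-++ (c ∷ v) w = trans (cong (_++ flip c ∷ []) (mirror-++ v w)) (++-assoc (mirror w) (mirror v) _)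

mirror-involutive : ∀ w → mirror (mirror w) ≡ w
mirror-involutive []      = refl
mirror-involutive (c ∷ w) =
  trans (mirror-++ (mirror w) (flip c ∷ [])) (cong₂ _∷_ (flip-involutive c) (mirror-involutive w))

length-mirror : ∀ w → length (mirror w) ≡ length w
length-mirror []      = refl
length-mirror (c ∷ w) = trans (length-++ (mirror w)) (trans (+-comm _ 1) (cong suc (length-mirror w)))

-- The reason why a final `D` of the half counts as a valley: the mirror image opens with the flip
-- of the last letter.
mirror-turn : ∀ w → last w ≡ just D → head (mirror w) ≡ just U
mirror-turn (D ∷ [])     refl = refl
mirror-turn (c ∷ c′ ∷ w) eq with mirror (c′ ∷ w) | mirror-turn (c′ ∷ w) eq
... | _ ∷ _ | eq′ = eq′

++-injectiveʳ : ∀ {A : Set} (xs ys : List A) {xs′ ys′} → length xs ≡ length ys →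
                xs ++ xs′ ≡ ys ++ ys′ → xs′ ≡ ys′
++-injectiveʳ []       []       _   eq = eq
++-injectiveʳ (_ ∷ xs) (_ ∷ ys) len eq = ++-injectiveʳ xs ys (suc-injective len) (proj₂ (∷-injective eq))

double : ∀ m → m + m ≡ 2 * m
double m = cong (m +_) (sym (+-identityʳ m))

-- Mirroring `h ++ t` gives `mirror t ++ mirror h`. All four pieces have length `m`, so the second
-- pieces `t` and `mirror h` agree.
mirror-fixed⇒halves : ∀ {m} w → length w ≡ 2 * m → mirror w ≡ w →
                      length (take m w) ≡ m × w ≡ take m w ++ mirror (take m w)
mirror-fixed⇒halves {m} w len fixed = length-h , trans (sym (take++drop≡id m w)) (cong (h ++_) t≡mirror-h)
  where
  open ≡-Reasoning
  h = take m w
  t = drop m w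
  length-h : length h ≡ m
  length-h = trans (length-take m w) (m≤n⇒m⊓n≡m (subst (m ≤_) (sym len) (m≤m+n m _)))
  length-t : length t ≡ m
  length-t = +-cancelˡ-≡ m _ _ (begin
    m + length t          ≡⟨ cong (_+ length t) length-h ⟨
    length h + length t   ≡⟨ length-++ h ⟨
    length (h ++ t)       ≡⟨ cong length (take++drop≡id m w) ⟩
    length w              ≡⟨ len ⟩
    2 * m                 ≡⟨ double m ⟨
    m + m                 ∎)
  t≡mirror-h : t ≡ mirror h
  t≡mirror-h = ++-injectiveʳ h (mirror t) (trans length-h (sym (trans (length-mirror t) length-t))) (begin
    h ++ t                ≡⟨ take++drop≡id m w ⟩
    w                     ≡⟨ fixed ⟨
    mirror w              ≡⟨ cong mirror (take++drop≡id m w) ⟨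
    mirror (h ++ t)       ≡⟨ mirror-++ h t ⟩
    mirror t ++ mirror h  ∎)

symDyck⇒half : ∀ {m w} → IsSymDyck m w →
               ∃[ h ] ∃[ z ] length h ≡ m × Path 0 h z × w ≡ h ++ mirror h
symDyck⇒half {m} {w} ((len , bal , prefixes) , symm)
  with len-h , w≡ ← mirror-fixed⇒halves {m} w len (symmetric⇒mirror w symm)
  with z , path-h ← Path-split (take m w)
         (subst (λ w → Path 0 w 0) (sym (take++drop≡id m w)) (prefixes⇒Path w prefixes bal))
  = take m w , z , len-h , path-h , w≡

half⇒symDyck : ∀ {m h z} → length h ≡ m → Path 0 h z → IsSymDyck m (h ++ mirror h)
half⇒symDyck {m} {h} len p =
    ( trans (length-++ h) (trans (cong₂ _+_ len (trans (length-mirror h) len)) (double m))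
    , Path⇒balance q , Path⇒prefixes q)
  , mirror⇒symmetric (h ++ mirror h)
      (trans (mirror-++ h (mirror h)) (cong (_++ mirror h) (mirror-involutive h)))
  where q = p ++ᵖ Path-mirror p

-- The enumeration of words and of symmetric Dyck paths.

words-complete : ∀ w → w ∈ words (length w)
words-complete []      = here refl
words-complete (U ∷ w) = ∈-++⁺ˡ (∈-map⁺ (U ∷_) (words-complete w))
words-complete (D ∷ w) = ∈-++⁺ʳ (map (U ∷_) (words (length w))) (∈-map⁺ (D ∷_) (words-complete w))

words-unique : ∀ k → Unique (words k)
words-unique zero    = [] ∷ []
words-unique (suc k) = Unique.++⁺ (Unique.map⁺ (proj₂ ∘ ∷-injective) (words-unique k))
  (Unique.map⁺ (proj₂ ∘ ∷-injective) (words-unique k))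
  λ (∈U , ∈D) → disjoint (∈-map⁻ _ ∈U) (∈-map⁻ _ ∈D)
  where
  disjoint : ∀ {w} → (∃[ v ] v ∈ words k × w ≡ U ∷ v) → ¬ (∃[ v ] v ∈ words k × w ≡ D ∷ v)
  disjoint (_ , _ , refl) (_ , _ , ())

∈-SDyck⁻ : ∀ {m w} → w ∈ SDyck m → IsSymDyck m w
∈-SDyck⁻ {m} w∈ = proj₂ (∈-filter⁻ (isSymDyck? m) {xs = words (2 * m)} w∈)

∈-SDyck⁺ : ∀ {m w} → IsSymDyck m w → w ∈ SDyck m
∈-SDyck⁺ {m} {w} dyck@((len , _) , _) =
  ∈-filter⁺ (isSymDyck? m) (subst (λ k → w ∈ words k) len (words-complete w)) dyck

-- Faces as chains of points.

Vhalf-mirror : ∀ {n h z} → length h ≡ 2 * n → Path 0 h z →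
               Vhalf n (h ++ mirror h) ≡ map position (valleys 0 0 h)
Vhalf-mirror {h = h} len p = filter-valleysFrom 0 0 0 h (mirror h) len refl p (mirror-turn h)

point : Position → Point
point p = d p , u p

point∘position : ∀ {p} → proj₁ p ≤ proj₂ p → point (position p) ≡ p
-- With `b = a + k` the position is `(2a + k , k)`, so both halvings are exact.
point∘position {a , b} a≤b with k , refl ← m≤n⇒∃[o]m+o≡n a≤b
  rewrite m+n∸m≡n a k = cong₂ _,_
    (trans (cong (_/ 2) (trans (cong (_∸ k) (d-eq a k)) (m+n∸n≡m (a * 2) k))) (m*n/n≡m a 2))
    (trans (cong (_/ 2) (u-eq a k)) (m*n/n≡m (a + k) 2))
  where
  d-eq : ∀ a k → a + (a + k) ≡ a * 2 + k
  d-eq = solve-∀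
  u-eq : ∀ a k → a + (a + k) + k ≡ (a + k) * 2
  u-eq = solve-∀

-- The origin in front forces positive coordinates and turns the stretch before the first valley
-- into a gap like the others.
Chain : ℕ → List Point → Set
Chain N qs = AllPairs _≺_ ((0 , 0) ∷ qs) × All (Valid N) qs

valleys-chain : ∀ {N w z} → length w ≡ N → Path 0 w z → Chain N (valleys 0 0 w)
valleys-chain {w = w} refl p =
    -- `valleys-after` gives only `0 ≤ b` here; `0 < b` comes from `0 < a ≤ b`.
    All.zipWith (λ ((0<a , _) , (a≤b , _)) → 0<a , <-≤-trans 0<a a≤b) (valleys-after 0 0 w , valid)
    ∷ valleys-sorted 0 0 w
  , valid
  where valid = valleys-valid 0 0 refl p

Vhalf-chain : ∀ {n w} → w ∈ SDyck (2 * n) → ∃[ qs ] Chain (2 * n) qs × Vhalf n w ≡ map position qs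
Vhalf-chain {n} w∈ with h , z , len , p , refl ← symDyck⇒half (∈-SDyck⁻ {2 * n} w∈) =
  valleys 0 0 h , valleys-chain len p , Vhalf-mirror {n} len p

chain-Vhalf : ∀ {n qs} → Chain (2 * n) qs → ∃[ w ] w ∈ SDyck (2 * n) × Vhalf n w ≡ map position qs
chain-Vhalf {n} {qs} (sorted , valid) =
    h ++ mirror h
  , ∈-SDyck⁺ {2 * n} (half⇒symDyck len (proj₂ p))
  , trans (Vhalf-mirror {n} len (proj₂ p)) (cong (map position) (valleys-halfPath linked))
  where
  h = halfPath (2 * n) (0 , 0) qs
  linked = AllPairs⇒Linked sorted
  len = length-halfPath linked ((z≤n , z≤n) ∷ valid)
  p = Path-halfPath linked valid refl

map-point∘position : ∀ {N qs} → All (Valid N) qs → map point (map position qs) ≡ qs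
map-point∘position {qs = qs} valid =
  trans (sym (map-∘ qs)) (map-id-local (All.map (point∘position ∘ proj₁) valid))

-- On valid points `position` is inverted by `point`, so an inclusion of faces carries back to the
-- chains, which are sorted.
position-⊆ : ∀ {N qs rs} → Chain N qs → Chain N rs → map position qs Subset.⊆ map position rs → qs ⊑ rs
position-⊆ (_ ∷ sq , vq) (_ ∷ sr , vr) s = ⊆⇒⊑ ≺-irrefl ≺-trans sq sr
  (subst₂ Subset._⊆_ (map-point∘position vq) (map-point∘position vr) (Subset.map⁺ point s))

position-≐ : ∀ {N qs rs} → Chain N qs → Chain N rs → map position qs ≐ map position rs → qs ≡ rs
position-≐ cq cr (s , t) = Sublist.⊆-antisym (position-⊆ cq cr s) (position-⊆ cr cq t)

Vhalf-injective : ∀ {n v w} → v ∈ SDyck (2 * n) → w ∈ SDyck (2 * n) → Vhalf n v ≐ Vhalf n w → v ≡ w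
Vhalf-injective {n} v∈ w∈ eq
  with h , _ , len , p , refl ← symDyck⇒half (∈-SDyck⁻ {2 * n} v∈)
     | k , _ , len′ , q , refl ← symDyck⇒half (∈-SDyck⁻ {2 * n} w∈)
  = cong (λ h → h ++ mirror h) (valleys-injective 0 0 h k (trans len (sym len′))
      (position-≐ (valleys-chain len p) (valleys-chain len′ q)
        (subst₂ _≐_ (Vhalf-mirror {n} len p) (Vhalf-mirror {n} len′ q) eq)))

-- The degree of a face equals `μB`.

μ-tail-position : ∀ {N} n p qs → All (Valid N) (p ∷ qs) →
                  μ-tail n (position p) (map position qs) ≡ capacity (2 * n) p qs
μ-tail-position n p [] ((p≤ , _) ∷ []) =
  cong (λ (a , b) → (2 * n ∸ a ∸ b) / 2) (point∘position p≤)
μ-tail-position n p (q ∷ qs) ((p≤ , _) ∷ v@((q≤ , _) ∷ _)) = cong₂ _+_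
  (cong₂ (λ (a , b) (c , d) → (c ∸ a) ⊓ (d ∸ b)) (point∘position p≤) (point∘position q≤))
  (μ-tail-position n q qs v)

μ-positions-chain : ∀ {n qs} → Chain (2 * n) qs → μ-positions n (map position qs) ≡ capacity (2 * n) (0 , 0) qs
μ-positions-chain {n} {[]} _ = sym (trans (cong (_/ 2) (*-comm 2 n)) (m*n/n≡m n 2))
μ-positions-chain {n} {q@(a , b) ∷ qs} (_ , v@((a≤b , _) ∷ _)) = cong₂ _+_
  (trans (cong proj₁ (point∘position a≤b)) (sym (m≤n⇒m⊓n≡m a≤b)))
  (μ-tail-position n q qs v)

-- The saturated chain is realised by a path and attains the value. Conversely, any face containing
-- `σ` comes from a chain that has `qs` as a sublist, so `length≤capacity` bounds its size.
degree-chain : ∀ {n qs} → Chain (2 * n) qs →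
               degree (map (Vhalf n) (SDyck (2 * n))) (map position qs) ≡ capacity (2 * n) (0 , 0) qs
degree-chain {n} {qs} cq@(sorted , valid) = max≈v⁺ attained (All.tabulate bounded) z≤n
  where
  N = 2 * n
  σ = map position qs
  Δ = map (Vhalf n) (SDyck (2 * n))
  σ⊆? = DecSubset._⊆?_ _≟ᵖ_ σ
  linked = AllPairs⇒Linked sorted
  full = saturate N (0 , 0) qs
  attained : capacity N (0 , 0) qs ∈ map length (filter σ⊆? Δ)
  attained
    with w , w∈ , eq ← chain-Vhalf {n} {full}
           ( Linked⇒AllPairs ≺-trans (saturate-linked linked)
           , saturate-valid linked ((z≤n , z≤n) ∷ valid))
    = subst (_∈ map length (filter σ⊆? Δ))
        (trans (cong length eq) (trans (length-map position full) (length-saturate linked)))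
        (∈-map⁺ length (∈-filter⁺ σ⊆? (∈-map⁺ (Vhalf n) w∈)
          (subst (σ Subset.⊆_) (sym eq) (Subset.map⁺ position (Sublist.lookup (⊑-saturate N (0 , 0) qs))))))
  bounded : ∀ {l} → l ∈ map length (filter σ⊆? Δ) → l ≤ capacity N (0 , 0) qs
  bounded l∈
    with τ , τ∈ , refl ← ∈-map⁻ length l∈
    with τ∈Δ , σ⊆τ ← ∈-filter⁻ σ⊆? {xs = Δ} τ∈
    with w , w∈ , refl ← ∈-map⁻ (Vhalf n) τ∈Δ
    with rs , cr@(sr , vr) , eq ← Vhalf-chain {n} w∈
    = subst (_≤ _) (sym (trans (cong length eq) (length-map position rs)))
        (length≤capacity sr vr (position-⊆ cq cr (subst (σ Subset.⊆_) eq σ⊆τ)))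

degree≡μB : ∀ {n w} → w ∈ SDyck (2 * n) → degree (map (Vhalf n) (SDyck (2 * n))) (Vhalf n w) ≡ μB n w
degree≡μB {n} w∈ with qs , cq , eq ← Vhalf-chain {n} w∈ =
  trans (cong (degree (map (Vhalf n) (SDyck (2 * n)))) eq)
    (trans (degree-chain {n} cq)
      (sym (trans (cong (μ-positions n) eq) (μ-positions-chain {n} cq))))

-- Counting faces by paths.

deduplicate-id : ∀ {A : Set} {R : Rel A 0ℓ} (R? : B.Decidable R) {xs} →
                 AllPairs (λ x y → ¬ R x y) xs → deduplicate R? xs ≡ xs
deduplicate-id R? []                     = refl
deduplicate-id R? {x ∷ xs} (¬Rx ∷ ¬Rxs) =
  cong (x ∷_) (trans (cong (filter _) (deduplicate-id R? ¬Rxs)) (filter-all (¬? ∘ R? x) ¬Rx))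

AllPairs-map-∈ : ∀ {A : Set} {R S : Rel A 0ℓ} {xs} → (∀ {x y} → x ∈ xs → y ∈ xs → R x y → S x y) →
                 AllPairs R xs → AllPairs S xs
AllPairs-map-∈ f []         = []
AllPairs-map-∈ f (px ∷ pxs) =
  All.tabulate (λ y∈ → f (here refl) (there y∈) (All.lookup px y∈))
  ∷ AllPairs-map-∈ (λ x∈ y∈ → f (there x∈) (there y∈)) pxs

-- By `Vhalf-injective` distinct paths give distinct faces, so there are no repetitions to remove
-- and faces correspond one to one to paths.
ΔSDyck≡ : ∀ n → ΔSDyck n ≡ map (Vhalf n) (SDyck (2 * n))
ΔSDyck≡ n = deduplicate-id _≐?_ (AllPairs.map⁺ (AllPairs-map-∈
  (λ v∈ w∈ v≢w eq → v≢w (Vhalf-injective {n} v∈ w∈ eq))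
  (Unique.filter⁺ (isSymDyck? (2 * n)) (words-unique (2 * (2 * n))))))

length-filter-map : ∀ {A B : Set} {P : Pred B 0ℓ} {Q : Pred A 0ℓ} (P? : Decidable P) (Q? : Decidable Q)
                    (f : A → B) xs → (∀ {x} → x ∈ xs → P (f x) ⇔ Q x) →
                    length (filter P? (map f xs)) ≡ length (filter Q? xs)
length-filter-map P? Q? f []       _ = refl
length-filter-map P? Q? f (x ∷ xs) e with P? (f x) | Q? x
... | yes _  | yes _  = cong suc (length-filter-map P? Q? f xs (e ∘ there))
... | no _   | no _   = length-filter-map P? Q? f xs (e ∘ there)
... | yes p  | no ¬q  = contradiction (Equivalence.to (e (here refl)) p) ¬q
... | no ¬p  | yes q  = contradiction (Equivalence.from (e (here refl)) q) ¬p

theorem4p4 : ∀ (n : ℕ) → 1 ≤ n → ∀ (i j : ℕ) → j ≤ i → i ≤ n →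
    fTriangle (ΔSDyck n) i j
    ≡ length (filter (λ w → (length (Vhalf n w) ≟ j) ×-dec (μB n w ≟ i)) (SDyck (2 * n)))
theorem4p4 n _ i j _ _ = trans (cong (λ Δ → fTriangle Δ i j) (ΔSDyck≡ n))
  -- The conditions on size coincide literally; those on degree and `μB` are exchanged by
  -- `degree≡μB`.
  (length-filter-map _ _ (Vhalf n) (SDyck (2 * n)) λ w∈ →
    mk⇔ (map₂ (trans (sym (degree≡μB {n} w∈)))) (map₂ (trans (degree≡μB {n} w∈))))
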